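{- Let $p=(f_i)_{i\in I}\in\mathcal P$. If $\Delta^r_{\mathcal P}(p)\le l_r$ for every index $r$ (that is, for every row index $m$ and every column index $n$ of $P_l$), then the optimal value of the original problem $P$ is at least $\omega_{\mathcal P}(p)$, and $\omega_{\mathcal P}(p)\ge\omega_0$, where $\omega_0$ is the optimal value of the linear problem $P_l$.
   Context: Linear problem. $P_l$ is the linear program: minimize $\sum_n c_n x_n$ subject to $\sum_n c_{m,n}x_n\ge b_m$ for all $m$, and $x_n\ge 0$ for all $n$ (finitely many real variables $x_n$ and inequalities indexed by $m$; the index sets $\{m\}$ and $\{n\}$ are taken disjoint, and $r$ denotes an index running over their union). It has finite optimal value $\omega_0$. Its dual solution space is $V_0=\{y: y_m\ge 0\ \forall m,\ r_n(y)\ge 0\ \forall n\}$, where $r_n(y)=c_n-\sum_m c_{m,n}y_m$ is the reduced cost of $x_n$, and its dual objective is $\omega(y)=\sum_m b_m y_m$ (to be maximized). $L_0\subseteq V_0$ is the set of optimal dual solutions. Fix $y\in L_0$, so $\omega(y)=\omega_0$. Let $l$ be the vector with $l_m=y_m$ and $l_n=r_n(y)$. Problem $P$. $P$ minimizes the same objective $\sum_n c_nx_n$ over a subset of the feasible set of $P_l$. There are finitely many case differentiations $i\in I$, each with a finite nonempty set of cases $j\in J_i$. Case $j$ of differentiation $i$ consists of finitely many additional linear inequalities $\sum_n d^{i,j}_{k,n}x_n\ge e^{i,j}_k$ (indexed by $k$). For every $i\in I$, every feasible point of $P$ satisfies all inequalities of at least one case $j\in J_i$. The optimal value of $P$ is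 the infimum of the objective over its feasible points ($+\infty$ if there are none). Cases. $V_{i,j}$ is the dual solution space of $P_l$ with the inequalities of case $(i,j)$ added: the set of pairs $(v,z)$ with $v_m\ge0$, $z_k\ge 0$ and $r_n(v,z):=c_n-\sum_m c_{m,n}v_m-\sum_k d^{i,j}_{k,n}z_k\ge 0$ for all $m,k,n$. Its objective is the linear function $\omega_{i,j}(v,z)=\sum_m b_mv_m+\sum_k e^{i,j}_kz_k$. The vector $y$ is identified with $(y,0)$. Put $P_{i,j}=\{w\in V_{i,j}:\omega_{i,j}(w)\ge\omega_0\}$ and $C_{i,j}=\{c: y+c\in P_{i,j}\}$. For $c_{i,j}\in C_{i,j}$ the value $\omega_{i,j}(c_{i,j})$ is that of the linear function $\omega_{i,j}$ at $c_{i,j}$, i.e. $\omega_{i,j}(y+c_{i,j})-\omega_{i,j}(y)$. Define $\Delta^m_{i,j}(c_{i,j})=y_m-(y+c_{i,j})_m=-(c_{i,j})_m$ for every row index $m$ of $P_l$, and $\Delta^n_{i,j}(c_{i,j})=r_n(y)-r_n(y+c_{i,j})$ for every column index $n$. Together these are $\Delta^r_{i,j}(c_{i,j})$. Files. $F_i=\bigoplus_{j\in J_i}C_{i,j}$, i.e. an element $f_i\in F_i$ is a family $(c_{i,j})_{j\in J_i}$ with $c_{i,j}\in C_{i,j}$. Define $\omega_i(f_i)=\min_{j}\omega_{i,j}(c_{i,j})$ and $\Delta_i^r(f_i)=\max_{j}\Delta^r_{i,j}(c_{i,j})$. Parallel files. $\mathcal P=\bigoplus_{i\in I}F_i$, i.e.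 elements $p\in\mathcal P$ are families $(f_i)_{i\in I}$ with $f_i\in F_i$. Define $\Delta^r_{\mathcal P}(p)=\sum_i\Delta_i^r(f_i)$ and $\omega_{\mathcal P}(p)=\omega_0+\sum_i\omega_i(f_i)$. -}

module Defs where

open import Level using (0ℓ)
open import Algebra.Bundles using (CommutativeRing)
open import Data.Fin using (Fin; zero; suc)
open import Data.Nat using (ℕ; zero; suc)
open import Data.Product using (Σ; ∃; _×_; _,_; proj₁; proj₂)
open import Data.Sum using (_⊎_; inj₁; inj₂)
open import Data.Vec.Functional using (Vector)
open import Relation.Binary.Bundles using (DecTotalOrder)
open import Relation.Binary.Core using (Rel)
open import Relation.Binary.Structures using (IsDecTotalOrder)
open import Relation.Nullary using (¬_)
open import Relation.Nullary.Construct.Add.Extrema using (_±; [_])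
import Algebra.Construct.NaturalChoice.Max as Max
import Algebra.Construct.NaturalChoice.Min as Min
import Algebra.Properties.CommutativeMonoid.Sum as Sum
import Relation.Binary.Construct.Add.Extrema.NonStrict as Extrema

-- The classical axioms of the real numbers: a Dedekind-complete, decidably
-- ordered field, which classically is unique up to isomorphism.
record RealNumbers : Set₁ where
  infix 4 _≤_
  field
    commutativeRing : CommutativeRing 0ℓ 0ℓ

  open CommutativeRing commutativeRing public

  field
    _≤_             : Rel Carrier 0ℓ
    isDecTotalOrder : IsDecTotalOrder _≈_ _≤_
    1≉0             : ¬ 1# ≈ 0#
    inverse         : ∀ x → ¬ x ≈ 0# → ∃ λ x⁻¹ → x * x⁻¹ ≈ 1#
    +-monoˡ-≤       : ∀ z {x y} → x ≤ y → x + z ≤ y + z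
    *-nonNegative   : ∀ {x y} → 0# ≤ x → 0# ≤ y → 0# ≤ x * y

  UpperBound : (Carrier → Set) → Carrier → Set
  UpperBound S u = ∀ x → S x → x ≤ u

  field
    complete : ∀ S → ∃ S → ∃ (UpperBound S) →
               ∃ λ s → UpperBound S s × (∀ u → UpperBound S u → s ≤ u)

  decTotalOrder : DecTotalOrder 0ℓ 0ℓ 0ℓ
  decTotalOrder = record { isDecTotalOrder = isDecTotalOrder }

module LinearProgramming (ℝ : RealNumbers) where
  open RealNumbers ℝ public hiding (zero)
  open Sum +-commutativeMonoid public using (sum)
  open Min (DecTotalOrder.totalOrder decTotalOrder) public using (_⊓_)
  open Max (DecTotalOrder.totalOrder decTotalOrder) public using (_⊔_)
  open Extrema _≤_ public using (_≤±_)

  minimum maximum : ∀ {k} → Vector Carrier (suc k) → Carrier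
  minimum {zero}  v = v zero
  minimum {suc k} v = v zero ⊓ minimum (λ j → v (suc j))
  maximum {zero}  v = v zero
  maximum {suc k} v = v zero ⊔ maximum (λ j → v (suc j))

  infix 7 _∙_
  _∙_ : ∀ {n} → Vector Carrier n → Vector Carrier n → Carrier
  u ∙ v = sum (λ i → u i * v i)

  -- The infimum of f over S in the extended reals: +∞ if S is empty and
  -- -∞ if f is unbounded below on S.
  IsOptimalValue : ∀ {n} → (Vector Carrier n → Set) →
                   (Vector Carrier n → Carrier) → Carrier ± → Set
  IsOptimalValue S f v = LowerBound v × (∀ u → LowerBound u → u ≤± v)
    where
    LowerBound : Carrier ± → Set
    LowerBound u = ∀ x → S x → u ≤± [ f x ]

  -- The objective c ∙ x is to be minimised.
  record LinearProgram (M N : ℕ) : Set where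
    field
      c : Vector Carrier N
      A : Fin M → Vector Carrier N
      b : Vector Carrier M

    objective : Vector Carrier N → Carrier
    objective x = c ∙ x

    Feasible : Vector Carrier N → Set
    Feasible x = (∀ m → b m ≤ A m ∙ x) × (∀ n → 0# ≤ x n)

    reducedCost : Vector Carrier M → Vector Carrier N
    reducedCost y n = c n - sum (λ m → A m n * y m)

    DualFeasible : Vector Carrier M → Set
    DualFeasible y = (∀ m → 0# ≤ y m) × (∀ n → 0# ≤ reducedCost y n)

    dualObjective : Vector Carrier M → Carrier
    dualObjective y = b ∙ y

    DualOptimal : Vector Carrier M → Set
    DualOptimal y = DualFeasible y ×
      (∀ y′ → DualFeasible y′ → dualObjective y′ ≤ dualObjective y)

  record Case (N : ℕ) : Set where
    field
      K : ℕ
      d : Fin K → Vector Carrier N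
      e : Vector Carrier K

    Satisfies : Vector Carrier N → Set
    Satisfies x = ∀ k → e k ≤ d k ∙ x

  -- The objective to be minimised over FeasibleP is that of Pl.
  record Problem {M N : ℕ} (Pl : LinearProgram M N) : Set₁ where
    open LinearProgram Pl using (Feasible)
    field
      FeasibleP   : Vector Carrier N → Set
      P⊆Pl        : ∀ x → FeasibleP x → Feasible x
      #I          : ℕ
      -- Differentiation i has suc (lastCase i) cases, hence at least one.
      lastCase    : Fin #I → ℕ

    I : Set
    I = Fin #I

    J : I → Set
    J i = Fin (suc (lastCase i))

    field
      case        : (i : I) → J i → Case N
      exhaustive  : ∀ i x → FeasibleP x → ∃ λ j → Case.Satisfies (case i j) x

  module ExtendedDual {M N : ℕ} (Pl : LinearProgram M N) (C : Case N) where
    open LinearProgram Pl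
    open Case C

    Dual : Set
    Dual = Vector Carrier M × Vector Carrier K

    infixl 6 _⊕_
    _⊕_ : Dual → Dual → Dual
    (v , z) ⊕ (v′ , z′) = (λ m → v m + v′ m) , (λ k → z k + z′ k)

    embed : Vector Carrier M → Dual
    embed y = y , (λ _ → 0#)

    extReducedCost : Dual → Vector Carrier N
    extReducedCost (v , z) n =
      (c n - sum (λ m → A m n * v m)) - sum (λ k → d k n * z k)

    V : Dual → Set
    V w@(v , z) = (∀ m → 0# ≤ v m) × (∀ k → 0# ≤ z k) ×
                  (∀ n → 0# ≤ extReducedCost w n)

    ω : Dual → Carrier
    ω (v , z) = b ∙ v + e ∙ z

  module Files {M N : ℕ} {Pl : LinearProgram M N} (P : Problem Pl)
               (ω₀ : Carrier) (y : Vector Carrier M) where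
    open LinearProgram Pl
    open Problem P
    private module E (i : I) (j : J i) = ExtendedDual Pl (case i j)

    Index : Set
    Index = Fin M ⊎ Fin N

    l : Index → Carrier
    l (inj₁ m) = y m
    l (inj₂ n) = reducedCost y n

    Pᵢⱼ : ∀ i j → E.Dual i j → Set
    Pᵢⱼ i j w = E.V i j w × ω₀ ≤ E.ω i j w

    Cᵢⱼ : (i : I) → J i → Set
    Cᵢⱼ i j = Σ (E.Dual i j) λ w → Pᵢⱼ i j (E._⊕_ i j (E.embed i j y) w)

    ωᵢⱼ : ∀ i j → Cᵢⱼ i j → Carrier
    ωᵢⱼ i j (w , _) = E.ω i j w

    Δᵢⱼ : ∀ i j → Cᵢⱼ i j → Index → Carrier
    Δᵢⱼ i j (w , _) (inj₁ m) = y m - proj₁ (E._⊕_ i j (E.embed i j y) w) m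
    Δᵢⱼ i j (w , _) (inj₂ n) =
      reducedCost y n - E.extReducedCost i j (E._⊕_ i j (E.embed i j y) w) n

    F : I → Set
    F i = (j : J i) → Cᵢⱼ i j

    ωᵢ : ∀ i → F i → Carrier
    ωᵢ i f = minimum (λ j → ωᵢⱼ i j (f j))

    Δᵢ : ∀ i → F i → Index → Carrier
    Δᵢ i f r = maximum (λ j → Δᵢⱼ i j (f j) r)

    𝒫 : Set
    𝒫 = (i : I) → F i

    Δ𝒫 : 𝒫 → Index → Carrier
    Δ𝒫 p r = sum (λ i → Δᵢ i (p i) r)

    ω𝒫 : 𝒫 → Carrier
    ω𝒫 p = ω₀ + sum (λ i → ωᵢ i (p i))

{-# OPTIONS --safe #-}

-- With s = A x − b, the duality gap at a feasible x is
-- c ∙ x − ω(y) = s ∙ y + x ∙ r(y), a nonnegatively weighted sum of the entries of l.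
-- If x satisfies case (i , j), the same weighting of Δᵢⱼ is at least ωᵢⱼ, so summing
-- over i and using Δ𝒫 ≤ l gives c ∙ x ≥ ω(y) + Σᵢ ωᵢ. Replacing ω(y) by ω₀ takes
-- strong duality, obtained from Farkas' lemma by Fourier–Motzkin elimination.
module Submission where

open import Defs
open import Data.Fin using (Fin; zero; suc)
open import Data.List using (List; []; _∷_; _++_; tabulate; cartesianProductWith)
open import Data.List.Membership.Propositional using (_∈_)
open import Data.List.Membership.Propositional.Properties using (∈-cartesianProductWith⁺)
open import Data.List.Relation.Unary.All as All using (All; []; _∷_)
import Data.List.Relation.Unary.All.Properties as All
open import Data.List.Relation.Unary.Any using (here; there)
open import Data.Nat as ℕ using (ℕ)
open import Data.Product using (∃; _×_; _,_; proj₁; proj₂)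
open import Data.Sum using (_⊎_; inj₁; inj₂)
open import Data.Vec.Functional as Vec using (Vector)
open import Relation.Binary.Bundles using (DecTotalOrder)
import Relation.Binary.Construct.Add.Extrema.NonStrict as Extrema
import Relation.Binary.PropositionalEquality as ≡
open import Relation.Nullary using (¬_; yes; no; contradiction)
open import Relation.Nullary.Construct.Add.Extrema using (_±; [_])

-- Arithmetic of the ordered field.

module OrderedField (ℝ : RealNumbers) where
  open LinearProgramming ℝ public
  open DecTotalOrder decTotalOrder public
    using (_≤?_; _≟_; total; antisym)
    renaming (refl to ≤-refl; trans to ≤-trans; reflexive to ≤-reflexive)
  open import Algebra.Properties.Ring ring public
    using (-‿distribˡ-*; -‿distribʳ-*; -1*x≈-x)
  open import Algebra.Properties.AbelianGroup +-abelianGroup public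
    using () renaming (⁻¹-∙-comm to -‿+-comm; ⁻¹-involutive to -‿involutive;
      ε⁻¹≈ε to -0≈0; ⁻¹-anti-homo‿- to -‿anti-homo‿-;
      //-rightDividesˡ to x-y+y≈x; //-rightDividesʳ to x+y-y≈x)
  open import Algebra.Properties.CommutativeSemigroup +-commutativeSemigroup public
    using () renaming (interchange to +-interchange)
  open import Algebra.Construct.NaturalChoice.Min (DecTotalOrder.totalOrder decTotalOrder) public
    using (x⊓y≤x; x⊓y≤y; ⊓-glb)
  open import Algebra.Construct.NaturalChoice.Max (DecTotalOrder.totalOrder decTotalOrder) public
    using (x≤x⊔y; x≤y⊔x; ⊔-lub)
  open import Relation.Binary.Reasoning.PartialOrder (DecTotalOrder.poset decTotalOrder) public

  +-monoʳ-≤ : ∀ z {x y} → x ≤ y → z + x ≤ z + y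
  +-monoʳ-≤ z {x} {y} x≤y = begin
    z + x  ≈⟨ +-comm z x ⟩
    x + z  ≤⟨ +-monoˡ-≤ z x≤y ⟩
    y + z  ≈⟨ +-comm y z ⟩
    z + y  ∎

  +-mono-≤ : ∀ {x y u v} → x ≤ y → u ≤ v → x + u ≤ y + v
  +-mono-≤ x≤y u≤v = ≤-trans (+-monoˡ-≤ _ x≤y) (+-monoʳ-≤ _ u≤v)

  +-nonNegative : ∀ {x y} → 0# ≤ x → 0# ≤ y → 0# ≤ x + y
  +-nonNegative {x} {y} 0≤x 0≤y = begin
    0#       ≈⟨ +-identityˡ 0# ⟨
    0# + 0#  ≤⟨ +-mono-≤ 0≤x 0≤y ⟩
    x + y    ∎

  +-cancelʳ-≤ : ∀ z {x y} → x + z ≤ y + z → x ≤ y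
  +-cancelʳ-≤ z {x} {y} x+z≤y+z = begin
    x          ≈⟨ x+y-y≈x z x ⟨
    x + z - z  ≤⟨ +-monoˡ-≤ (- z) x+z≤y+z ⟩
    y + z - z  ≈⟨ x+y-y≈x z y ⟩
    y          ∎

  x+y≤z⇒x≤z-y : ∀ {x y z} → x + y ≤ z → x ≤ z - y
  x+y≤z⇒x≤z-y {x} {y} {z} x+y≤z = begin
    x          ≈⟨ x+y-y≈x y x ⟨
    x + y - y  ≤⟨ +-monoˡ-≤ (- y) x+y≤z ⟩
    z - y      ∎

  x≤z-y⇒x+y≤z : ∀ {x y z} → x ≤ z - y → x + y ≤ z
  x≤z-y⇒x+y≤z {x} {y} {z} x≤z-y = begin
    x + y      ≤⟨ +-monoˡ-≤ y x≤z-y ⟩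
    z - y + y  ≈⟨ x-y+y≈x y z ⟩
    z          ∎

  x≤y⇒0≤y-x : ∀ {x y} → x ≤ y → 0# ≤ y - x
  x≤y⇒0≤y-x {x} x≤y = x+y≤z⇒x≤z-y (≤-trans (≤-reflexive (+-identityˡ x)) x≤y)

  0≤y-x⇒x≤y : ∀ {x y} → 0# ≤ y - x → x ≤ y
  0≤y-x⇒x≤y {x} 0≤y-x = ≤-trans (≤-reflexive (sym (+-identityˡ x))) (x≤z-y⇒x+y≤z 0≤y-x)

  -‿anti-≤ : ∀ {x y} → x ≤ y → - y ≤ - x
  -‿anti-≤ {x} {y} x≤y = 0≤y-x⇒x≤y (begin
    0#           ≤⟨ x≤y⇒0≤y-x x≤y ⟩
    y - x        ≈⟨ +-comm y (- x) ⟩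
    - x + y      ≈⟨ +-congˡ (-‿involutive y) ⟨
    - x - - y    ∎)

  x≤0⇒0≤-x : ∀ {x} → x ≤ 0# → 0# ≤ - x
  x≤0⇒0≤-x x≤0 = ≤-trans (≤-reflexive (sym -0≈0)) (-‿anti-≤ x≤0)

  -x*-y≈x*y : ∀ x y → - x * - y ≈ x * y
  -x*-y≈x*y x y = begin-equality
    - x * - y      ≈⟨ -‿distribˡ-* x (- y) ⟨
    - (x * - y)    ≈⟨ -‿cong (-‿distribʳ-* x y) ⟨
    - - (x * y)    ≈⟨ -‿involutive (x * y) ⟩
    x * y          ∎

  *-monoˡ-≤-nonNeg : ∀ {t x y} → 0# ≤ t → x ≤ y → t * x ≤ t * y
  *-monoˡ-≤-nonNeg {t} {x} {y} 0≤t x≤y = 0≤y-x⇒x≤y (begin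
    0#                 ≤⟨ *-nonNegative 0≤t (x≤y⇒0≤y-x x≤y) ⟩
    t * (y - x)        ≈⟨ distribˡ t y (- x) ⟩
    t * y + t * - x    ≈⟨ +-congˡ (-‿distribʳ-* t x) ⟨
    t * y - t * x      ∎)

  0≤1 : 0# ≤ 1#
  0≤1 with total 0# 1#
  ... | inj₁ 0≤1 = 0≤1
  ... | inj₂ 1≤0 = begin
    0#           ≤⟨ *-nonNegative (x≤0⇒0≤-x 1≤0) (x≤0⇒0≤-x 1≤0) ⟩
    - 1# * - 1#  ≈⟨ -x*-y≈x*y 1# 1# ⟩
    1# * 1#      ≈⟨ *-identityˡ 1# ⟩
    1#           ∎

  inverse-nonNegative : ∀ {x} → 0# ≤ x → ¬ x ≈ 0# → ∃ λ x⁻¹ → 0# ≤ x⁻¹ × x * x⁻¹ ≈ 1#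
  inverse-nonNegative {x} 0≤x x≉0 with inverse x x≉0
  ... | x⁻¹ , xx⁻¹≈1 with total 0# x⁻¹
  ...   | inj₁ 0≤x⁻¹ = x⁻¹ , 0≤x⁻¹ , xx⁻¹≈1
  ...   | inj₂ x⁻¹≤0 = contradiction (antisym 1≤0 0≤1) 1≉0
    where
    1≤0 : 1# ≤ 0#
    1≤0 = begin
      1#        ≈⟨ xx⁻¹≈1 ⟨
      x * x⁻¹   ≤⟨ *-monoˡ-≤-nonNeg 0≤x x⁻¹≤0 ⟩
      x * 0#    ≈⟨ zeroʳ x ⟩
      0#        ∎

  minimum-≤ : ∀ {k} (v : Vector Carrier (ℕ.suc k)) j → minimum v ≤ v j
  minimum-≤ {ℕ.zero}  v zero    = ≤-refl
  minimum-≤ {ℕ.suc k} v zero    = x⊓y≤x _ _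
  minimum-≤ {ℕ.suc k} v (suc j) = ≤-trans (x⊓y≤y _ _) (minimum-≤ (Vec.tail v) j)

  minimum-nonNegative : ∀ {k} {v : Vector Carrier (ℕ.suc k)} → (∀ j → 0# ≤ v j) → 0# ≤ minimum v
  minimum-nonNegative {ℕ.zero}  0≤v = 0≤v zero
  minimum-nonNegative {ℕ.suc k} 0≤v = ⊓-glb (0≤v zero) (minimum-nonNegative (λ j → 0≤v (suc j)))

  maximum-≥ : ∀ {k} (v : Vector Carrier (ℕ.suc k)) j → v j ≤ maximum v
  maximum-≥ {ℕ.zero}  v zero    = ≤-refl
  maximum-≥ {ℕ.suc k} v zero    = x≤x⊔y _ _
  maximum-≥ {ℕ.suc k} v (suc j) = ≤-trans (maximum-≥ (Vec.tail v) j) (x≤y⊔x _ _)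

-- Finite sums and dot products.

module DotProduct (ℝ : RealNumbers) where
  open OrderedField ℝ public
  open import Algebra.Properties.CommutativeMonoid.Sum +-commutativeMonoid public
    using (sum-cong-≋; sum-replicate-zero; ∑-distrib-+; ∑-comm)
  open import Algebra.Properties.Semiring.Sum semiring public
    using (*-distribˡ-sum)
  open import Algebra.Properties.CommutativeSemigroup *-commutativeSemigroup public
    using () renaming (x∙yz≈y∙xz to x*yz≈y*xz; x∙yz≈z∙yx to x*yz≈z*yx)

  sum-mono-≤ : ∀ {n} {u v : Vector Carrier n} → (∀ i → u i ≤ v i) → sum u ≤ sum v
  sum-mono-≤ {ℕ.zero}  u≤v = ≤-refl
  sum-mono-≤ {ℕ.suc n} u≤v = +-mono-≤ (u≤v zero) (sum-mono-≤ (λ i → u≤v (suc i)))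

  sum-nonNegative : ∀ {n} {u : Vector Carrier n} → (∀ i → 0# ≤ u i) → 0# ≤ sum u
  sum-nonNegative {n} 0≤u = ≤-trans (≤-reflexive (sym (sum-replicate-zero n))) (sum-mono-≤ 0≤u)

  ∙-cong : ∀ {n} {u u′ v v′ : Vector Carrier n} →
           (∀ i → u i ≈ u′ i) → (∀ i → v i ≈ v′ i) → u ∙ v ≈ u′ ∙ v′
  ∙-cong u≈u′ v≈v′ = sum-cong-≋ (λ i → *-cong (u≈u′ i) (v≈v′ i))

  ∙-congˡ : ∀ {n} (u : Vector Carrier n) {v v′} → (∀ i → v i ≈ v′ i) → u ∙ v ≈ u ∙ v′
  ∙-congˡ u = ∙-cong {u = u} (λ i → refl)

  ∙-comm : ∀ {n} (u v : Vector Carrier n) → u ∙ v ≈ v ∙ u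
  ∙-comm u v = sum-cong-≋ (λ i → *-comm (u i) (v i))

  ∙-zeroʳ : ∀ {n} (u : Vector Carrier n) → u ∙ (λ _ → 0#) ≈ 0#
  ∙-zeroʳ {n} u = trans (sum-cong-≋ (λ i → zeroʳ (u i))) (sum-replicate-zero n)

  ∙-distribˡ-+ : ∀ {n} (u v w : Vector Carrier n) → u ∙ (λ i → v i + w i) ≈ u ∙ v + u ∙ w
  ∙-distribˡ-+ u v w =
    trans (sum-cong-≋ (λ i → distribˡ (u i) (v i) (w i))) (∑-distrib-+ (λ i → u i * v i) (λ i → u i * w i))

  ∙-scaleʳ : ∀ {n} t (u v : Vector Carrier n) → u ∙ (λ i → t * v i) ≈ t * (u ∙ v)
  ∙-scaleʳ t u v =
    trans (sum-cong-≋ (λ i → x*yz≈y*xz (u i) t (v i))) (sym (*-distribˡ-sum t (λ i → u i * v i)))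

  ∙-negʳ : ∀ {n} (u v : Vector Carrier n) → u ∙ (λ i → - v i) ≈ - (u ∙ v)
  ∙-negʳ u v = begin-equality
    u ∙ (λ i → - v i)       ≈⟨ ∙-congˡ u (λ i → -1*x≈-x (v i)) ⟨
    u ∙ (λ i → - 1# * v i)  ≈⟨ ∙-scaleʳ (- 1#) u v ⟩
    - 1# * (u ∙ v)          ≈⟨ -1*x≈-x (u ∙ v) ⟩
    - (u ∙ v)               ∎

  ∙-distribˡ-- : ∀ {n} (u v w : Vector Carrier n) → u ∙ (λ i → v i - w i) ≈ u ∙ v - u ∙ w
  ∙-distribˡ-- u v w = trans (∙-distribˡ-+ u v (λ i → - w i)) (+-congˡ (∙-negʳ u w))

  ∙-distribˡ-sum : ∀ {n k} (u : Vector Carrier n) (f : Fin k → Vector Carrier n) →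
                   u ∙ (λ i → sum (λ j → f j i)) ≈ sum (λ j → u ∙ f j)
  ∙-distribˡ-sum u f =
    trans (sum-cong-≋ (λ i → *-distribˡ-sum (u i) (λ j → f j i))) (∑-comm (λ i j → u i * f j i))

  -- The inner sum is the transpose of `B` applied to `w`; moving it across the dot product
  -- exchanges two sums. It serves the rows `A` of the program and the rows `d` of a case alike.
  ∙-adjoint : ∀ {n k} (B : Fin k → Vector Carrier n) (x : Vector Carrier n) (w : Vector Carrier k) →
              x ∙ (λ i → sum (λ j → B j i * w j)) ≈ w ∙ (λ j → B j ∙ x)
  ∙-adjoint B x w = trans (∙-distribˡ-sum x (λ j i → B j i * w j)) (sum-cong-≋ (λ j →
    trans (sum-cong-≋ (λ i → x*yz≈z*yx (x i) (B j i) (w j))) (sym (*-distribˡ-sum (w j) (λ i → B j i * x i)))))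

  ∙-monoʳ-≤ : ∀ {n} {u v w : Vector Carrier n} →
              (∀ i → 0# ≤ u i) → (∀ i → v i ≤ w i) → u ∙ v ≤ u ∙ w
  ∙-monoʳ-≤ 0≤u v≤w = sum-mono-≤ (λ i → *-monoˡ-≤-nonNeg (0≤u i) (v≤w i))

  unit : ∀ {n} → Fin n → Vector Carrier n
  unit zero    = 1# Vec.∷ λ _ → 0#
  unit (suc i) = 0# Vec.∷ unit i

  unit-nonNegative : ∀ {n} (i j : Fin n) → 0# ≤ unit i j
  unit-nonNegative zero    zero    = 0≤1
  unit-nonNegative zero    (suc j) = ≤-refl
  unit-nonNegative (suc i) zero    = ≤-refl
  unit-nonNegative (suc i) (suc j) = unit-nonNegative i j

  ∙-unit : ∀ {n} (u : Vector Carrier n) i → u ∙ unit i ≈ u i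
  ∙-unit u zero =
    trans (+-cong (*-identityʳ (u zero)) (∙-zeroʳ (Vec.tail u))) (+-identityʳ (u zero))
  ∙-unit u (suc i) =
    trans (+-cong (zeroʳ (u zero)) (∙-unit (Vec.tail u) i)) (+-identityˡ (u (suc i)))

-- Farkas' lemma by Fourier-Motzkin elimination.

module Farkas (ℝ : RealNumbers) where
  open DotProduct ℝ

  -- The row (a , β) stands for the inequality β ≤ a ∙ x.
  Row : ℕ → Set
  Row n = Vector Carrier n × Carrier

  infix 4 _≋_
  _≋_ : ∀ {n} → Row n → Row n → Set
  (a , β) ≋ (a′ , β′) = (∀ i → a i ≈ a′ i) × β ≈ β′

  infixl 6 _⊞_
  _⊞_ : ∀ {n} → Row n → Row n → Row n
  (a , β) ⊞ (a′ , β′) = (λ i → a i + a′ i) , β + β′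

  infixr 7 _⊡_
  _⊡_ : ∀ {n} → Carrier → Row n → Row n
  t ⊡ (a , β) = (λ i → t * a i) , t * β

  cons : ∀ {n} → Carrier → Row n → Row (ℕ.suc n)
  cons σ (a , β) = σ Vec.∷ a , β

  -- Stands in for explicit multipliers: a row lying in every convex cone that contains given rows
  -- is derivable from them by addition and nonnegative scaling. `resp` is a field because rows are
  -- compared only up to `≈`.
  record ConvexCone {n} (Q : Row n → Set) : Set where
    field
      resp  : ∀ {r r′} → r ≋ r′ → Q r → Q r′
      add   : ∀ {r r′} → Q r → Q r′ → Q (r ⊞ r′)
      scale : ∀ {t r} → 0# ≤ t → Q r → Q (t ⊡ r)

  Satisfies : ∀ {n} → Vector Carrier n → Row n → Set
  Satisfies x (a , β) = β ≤ a ∙ x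

  satisfies-convexCone : ∀ {n} (x : Vector Carrier n) → ConvexCone (Satisfies x)
  satisfies-convexCone x = record
    { resp  = λ { {a , β} {a′ , β′} (a≈a′ , β≈β′) β≤ax → begin
        β′      ≈⟨ β≈β′ ⟨
        β       ≤⟨ β≤ax ⟩
        a ∙ x   ≈⟨ ∙-cong a≈a′ (λ i → refl) ⟩
        a′ ∙ x  ∎ }
    ; add   = λ { {a , β} {a′ , β′} β≤ax β′≤a′x → begin
        β + β′                     ≤⟨ +-mono-≤ β≤ax β′≤a′x ⟩
        a ∙ x + a′ ∙ x             ≈⟨ +-cong (∙-comm a x) (∙-comm a′ x) ⟩
        x ∙ a + x ∙ a′             ≈⟨ ∙-distribˡ-+ x a a′ ⟨
        x ∙ (λ i → a i + a′ i)     ≈⟨ ∙-comm x _ ⟩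
        (λ i → a i + a′ i) ∙ x     ∎ }
    ; scale = λ { {t} {a , β} 0≤t β≤ax → begin
        t * β                  ≤⟨ *-monoˡ-≤-nonNeg 0≤t β≤ax ⟩
        t * (a ∙ x)            ≈⟨ *-congˡ (∙-comm a x) ⟩
        t * (x ∙ a)            ≈⟨ ∙-scaleʳ t x a ⟨
        x ∙ (λ i → t * a i)    ≈⟨ ∙-comm x _ ⟩
        (λ i → t * a i) ∙ x    ∎ }
    }

  -- The two rows lie on the same ray, so a convex cone contains both or neither.
  infix 4 _∼_
  _∼_ : ∀ {n} → Row n → Row n → Set
  r ∼ r′ = (∃ λ t → 0# ≤ t × t ⊡ r ≋ r′) × (∃ λ t → 0# ≤ t × t ⊡ r′ ≋ r)

  module _ {n} {Q : Row n → Set} (cone : ConvexCone Q) {r r′ : Row n} where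
    open ConvexCone cone

    ∼-to : r ∼ r′ → Q r → Q r′
    ∼-to ((t , 0≤t , tr≋r′) , _) q = resp tr≋r′ (scale 0≤t q)

    ∼-from : r ∼ r′ → Q r′ → Q r
    ∼-from (_ , (t , 0≤t , tr′≋r)) q = resp tr′≋r (scale 0≤t q)

  -- Turns a cone in `suc n` variables into one in `n` variables, to which the induction hypothesis
  -- of `farkas` applies.
  consZero-convexCone : ∀ {n} {Q : Row (ℕ.suc n) → Set} →
                        ConvexCone Q → ConvexCone (λ r → Q (cons 0# r))
  consZero-convexCone cone = record
    { resp  = λ { (a≈a′ , β≈β′) → resp ((λ { zero → refl ; (suc i) → a≈a′ i }) , β≈β′) }
    ; add   = λ q q′ → resp ((λ { zero → +-identityˡ 0# ; (suc i) → refl }) , refl) (add q q′)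
    ; scale = λ {t} 0≤t q →
        resp ((λ { zero → zeroʳ t ; (suc i) → refl }) , refl) (scale 0≤t q)
    }
    where open ConvexCone cone

  -- `α` is the absolute value of the leading coefficient and `σ` its sign, except that a zero
  -- coefficient takes `α` = 1 and `σ` = 0. Scaling by `α⁻¹` leads to the normalised row, scaling by
  -- `α` leads back.
  ∼-normalised : ∀ {n} (r : Row (ℕ.suc n)) {σ α α⁻¹} → 0# ≤ α → 0# ≤ α⁻¹ → α * α⁻¹ ≈ 1# →
                 proj₁ r zero ≈ α * σ →
                 r ∼ cons σ (α⁻¹ ⊡ (Vec.tail (proj₁ r) , proj₂ r))
  ∼-normalised (a , β) {σ} {α} {α⁻¹} 0≤α 0≤α⁻¹ αα⁻¹≈1 a₀≈ασ =
    (α⁻¹ , 0≤α⁻¹ , (λ { zero → α⁻¹a₀≈σ ; (suc i) → refl }) , refl) ,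
    (α , 0≤α , (λ { zero → sym a₀≈ασ ; (suc i) → cancel (a (suc i)) }) , cancel β)
    where
    cancel : ∀ x → α * (α⁻¹ * x) ≈ x
    cancel x = begin-equality
      α * (α⁻¹ * x)  ≈⟨ *-assoc α α⁻¹ x ⟨
      α * α⁻¹ * x    ≈⟨ *-congʳ αα⁻¹≈1 ⟩
      1# * x         ≈⟨ *-identityˡ x ⟩
      x              ∎
    α⁻¹a₀≈σ : α⁻¹ * a zero ≈ σ
    α⁻¹a₀≈σ = begin-equality
      α⁻¹ * a zero   ≈⟨ *-congˡ a₀≈ασ ⟩
      α⁻¹ * (α * σ)  ≈⟨ x*yz≈y*xz α⁻¹ α σ ⟩
      α * (α⁻¹ * σ)  ≈⟨ cancel σ ⟩
      σ              ∎

  -- At a point `z Vec.∷ x`, leading coefficient 1 reads `β - a ∙ x ≤ z`, coefficient -1 reads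
  -- `z ≤ a ∙ x - β`, and coefficient 0 leaves `z` unconstrained.
  data Normalised {n} (r : Row (ℕ.suc n)) : Set where
    lower : ∀ r′ → r ∼ cons 1# r′ → Normalised r
    upper : ∀ r′ → r ∼ cons (- 1#) r′ → Normalised r
    free  : ∀ r′ → r ∼ cons 0# r′ → Normalised r

  normalise : ∀ {n} (r : Row (ℕ.suc n)) → Normalised r
  normalise r@(a , β) with a zero ≟ 0# | total 0# (a zero)
  ... | yes a₀≈0 | _ =
    free _ (∼-normalised r 0≤1 0≤1 (*-identityˡ 1#) (trans a₀≈0 (sym (zeroʳ 1#))))
  ... | no a₀≉0 | inj₁ 0≤a₀ with inverse-nonNegative 0≤a₀ a₀≉0
  ...   | _ , 0≤t , a₀t≈1 = lower _ (∼-normalised r 0≤a₀ 0≤t a₀t≈1 (sym (*-identityʳ _)))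
  normalise r@(a , β) | no a₀≉0 | inj₂ a₀≤0
    with inverse-nonNegative (x≤0⇒0≤-x a₀≤0) -a₀≉0
    where
    -a₀≉0 : ¬ - a zero ≈ 0#
    -a₀≉0 -a₀≈0 = a₀≉0 (trans (sym (-‿involutive _)) (trans (-‿cong -a₀≈0) -0≈0))
  ...   | _ , 0≤t , -a₀t≈1 = upper _ (∼-normalised r (x≤0⇒0≤-x a₀≤0) 0≤t -a₀t≈1
          (sym (trans (-x*-y≈x*y _ _) (*-identityʳ _))))

  -- `to` and `from` together say that the three lists generate the same cone as `rs`. Elimination
  -- uses `from` at the rows satisfied by a point and `to` at an arbitrary cone.
  record Split {n} (rs : List (Row (ℕ.suc n))) : Set₁ where
    field
      lowers uppers frees : List (Row n)
      to   : ∀ {Q} → ConvexCone Q → All Q rs →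
             All (λ r → Q (cons 1# r)) lowers × All (λ r → Q (cons (- 1#) r)) uppers ×
             All (λ r → Q (cons 0# r)) frees
      from : ∀ {Q} → ConvexCone Q →
             All (λ r → Q (cons 1# r)) lowers → All (λ r → Q (cons (- 1#) r)) uppers →
             All (λ r → Q (cons 0# r)) frees → All Q rs

  split : ∀ {n} (rs : List (Row (ℕ.suc n))) → Split rs
  split [] = record
    { lowers = [] ; uppers = [] ; frees = []
    ; to = λ _ _ → [] , [] , [] ; from = λ _ _ _ _ → [] }
  split (r ∷ rs) with normalise r | split rs
  ... | lower r′ r∼ | s = record
    { lowers = r′ ∷ lowers ; uppers = uppers ; frees = frees
    ; to = λ { c (q ∷ qs) → let ls , us , fs = to c qs in ∼-to c r∼ q ∷ ls , us , fs }
    ; from = λ { c (l ∷ ls) us fs → ∼-from c r∼ l ∷ from c ls us fs } }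
    where open Split s
  ... | upper r′ r∼ | s = record
    { lowers = lowers ; uppers = r′ ∷ uppers ; frees = frees
    ; to = λ { c (q ∷ qs) → let ls , us , fs = to c qs in ls , ∼-to c r∼ q ∷ us , fs }
    ; from = λ { c ls (u ∷ us) fs → ∼-from c r∼ u ∷ from c ls us fs } }
    where open Split s
  ... | free r′ r∼ | s = record
    { lowers = lowers ; uppers = uppers ; frees = r′ ∷ frees
    ; to = λ { c (q ∷ qs) → let ls , us , fs = to c qs in ls , us , ∼-to c r∼ q ∷ fs }
    ; from = λ { c ls us (f ∷ fs) → ∼-from c r∼ f ∷ from c ls us fs } }
    where open Split s

  -- The witness takes minima over `ys` first and then maxima over `xs`; by hypothesis each new
  -- maximum stays below every `g y`.
  separate : ∀ {A B : Set} (f : A → Carrier) (g : B → Carrier) xs ys →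
             (∀ {x y} → x ∈ xs → y ∈ ys → f x ≤ g y) →
             ∃ λ z → All (λ x → f x ≤ z) xs × All (λ y → z ≤ g y) ys
  -- With nothing to separate, 0 is an arbitrary starting value.
  separate f g [] [] _ = 0# , [] , []
  separate f g [] (y ∷ ys) _ with separate f g [] ys (λ ())
  ... | z , _ , z≤ys = g y ⊓ z , [] ,
        x⊓y≤x (g y) z ∷ All.map (≤-trans (x⊓y≤y (g y) z)) z≤ys
  separate f g (x ∷ xs) ys xs≤ys with separate f g xs ys (λ x∈ → xs≤ys (there x∈))
  ... | z , xs≤z , z≤ys = f x ⊔ z ,
        x≤x⊔y (f x) z ∷ All.map (λ x′≤z → ≤-trans x′≤z (x≤y⊔x (f x) z)) xs≤z ,
        All.tabulate (λ y∈ → ⊔-lub (xs≤ys (here ≡.refl) y∈) (All.lookup z≤ys y∈))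

  -- Adding a lower row to an upper row cancels the first variable. These sums and the free rows
  -- lose nothing: a solution of them leaves room for a value of the first variable, and they stay
  -- in every cone containing `rs`.
  eliminate : ∀ {n} (rs : List (Row (ℕ.suc n))) → ∃ λ (rs′ : List (Row n)) →
              (∀ x → All (Satisfies x) rs′ → ∃ λ z → All (Satisfies (z Vec.∷ x)) rs) ×
              (∀ {Q} → ConvexCone Q → All Q rs → All (λ r → Q (cons 0# r)) rs′)
  eliminate {n} rs = cartesianProductWith _⊞_ lowers uppers ++ frees , solve , combine
    where
    open Split (split rs)

    solve : ∀ x → All (Satisfies x) (cartesianProductWith _⊞_ lowers uppers ++ frees) →
            ∃ λ z → All (Satisfies (z Vec.∷ x)) rs
    solve x sat = z , from (satisfies-convexCone (z Vec.∷ x))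
      (All.map (λ {r} → lower-sat r) lowers≤z) (All.map (λ {r} → upper-sat r) z≤uppers)
      (All.map (λ {r} → free-sat r) (All.++⁻ʳ (cartesianProductWith _⊞_ lowers uppers) sat))
      where
      -- The combined row of `l` and `u`, rearranged, says that the lower bound on the eliminated
      -- variable is at most the upper bound, as `separate` requires.
      bound : ∀ {l u} → l ∈ lowers → u ∈ uppers → proj₂ l - proj₁ l ∙ x ≤ proj₁ u ∙ x - proj₂ u
      bound {a , β} {a′ , β′} l∈ u∈ = 0≤y-x⇒x≤y (begin
        0#                                 ≤⟨ x≤y⇒0≤y-x (All.lookup (All.++⁻ˡ _ sat) (∈-cartesianProductWith⁺ _⊞_ l∈ u∈)) ⟩
        (λ i → a i + a′ i) ∙ x - (β + β′)  ≈⟨ +-cong lemma (-‿cong (+-comm β β′)) ⟩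
        (a′ ∙ x + a ∙ x) - (β′ + β)        ≈⟨ +-congˡ (-‿+-comm β′ β) ⟨
        (a′ ∙ x + a ∙ x) + (- β′ - β)      ≈⟨ +-interchange (a′ ∙ x) (a ∙ x) (- β′) (- β) ⟩
        (a′ ∙ x - β′) + (a ∙ x - β)        ≈⟨ +-congˡ (-‿anti-homo‿- β (a ∙ x)) ⟨
        (a′ ∙ x - β′) - (β - a ∙ x)        ∎)
        where
        lemma : (λ i → a i + a′ i) ∙ x ≈ a′ ∙ x + a ∙ x
        lemma = begin-equality
          (λ i → a i + a′ i) ∙ x  ≈⟨ ∙-comm _ x ⟩
          x ∙ (λ i → a i + a′ i)  ≈⟨ ∙-distribˡ-+ x a a′ ⟩
          x ∙ a + x ∙ a′          ≈⟨ +-comm _ _ ⟩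
          x ∙ a′ + x ∙ a          ≈⟨ +-cong (∙-comm x a′) (∙-comm x a) ⟩
          a′ ∙ x + a ∙ x          ∎

      separation = separate (λ (a , β) → β - a ∙ x) (λ (a , β) → a ∙ x - β) lowers uppers bound
      z = proj₁ separation
      lowers≤z = proj₁ (proj₂ separation)
      z≤uppers = proj₂ (proj₂ separation)

      lower-sat : ∀ r → proj₂ r - proj₁ r ∙ x ≤ z → Satisfies (z Vec.∷ x) (cons 1# r)
      lower-sat (a , β) β-ax≤z = begin
        β                        ≈⟨ x-y+y≈x (a ∙ x) β ⟨
        β - a ∙ x + a ∙ x        ≤⟨ +-monoˡ-≤ (a ∙ x) β-ax≤z ⟩
        z + a ∙ x                ≈⟨ +-congʳ (*-identityˡ z) ⟨
        1# * z + a ∙ x           ∎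

      upper-sat : ∀ r → z ≤ proj₁ r ∙ x - proj₂ r → Satisfies (z Vec.∷ x) (cons (- 1#) r)
      upper-sat (a , β) z≤ax-β = begin
        β                   ≤⟨ x+y≤z⇒x≤z-y (≤-trans (≤-reflexive (+-comm β z)) (x≤z-y⇒x+y≤z z≤ax-β)) ⟩
        a ∙ x - z           ≈⟨ +-comm (a ∙ x) (- z) ⟩
        - z + a ∙ x         ≈⟨ +-congʳ (-1*x≈-x z) ⟨
        - 1# * z + a ∙ x    ∎

      free-sat : ∀ r → Satisfies x r → Satisfies (z Vec.∷ x) (cons 0# r)
      free-sat (a , β) β≤ax = begin
        β                ≤⟨ β≤ax ⟩
        a ∙ x            ≈⟨ +-identityˡ (a ∙ x) ⟨
        0# + a ∙ x       ≈⟨ +-congʳ (zeroˡ z) ⟨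
        0# * z + a ∙ x   ∎

    combine : ∀ {Q} → ConvexCone Q → All Q rs →
              All (λ r → Q (cons 0# r)) (cartesianProductWith _⊞_ lowers uppers ++ frees)
    combine cone qs with to cone qs
    ... | ls , us , fs = All.++⁺
      (All.cartesianProductWith⁺ (≡.setoid _) (≡.setoid _) _⊞_ lowers uppers (λ l∈ u∈ →
        resp ((λ { zero → -‿inverseʳ 1# ; (suc i) → refl }) , refl)
          (add (All.lookup ls l∈) (All.lookup us u∈))))
      fs
      where open ConvexCone cone

  -- Induction on the number of variables, one elimination per step. With no variables left a row
  -- reads `β ≤ 0#`, so either all rows hold or one of them is itself the contradiction. The
  -- refutation ranges over all cones so that its user can choose one recording suitable
  -- multipliers.
  farkas : ∀ {n} (rs : List (Row n)) →
           (∃ λ x → All (Satisfies x) rs) ⊎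
           (∀ {Q} → ConvexCone Q → All Q rs → ∃ λ β → ¬ β ≤ 0# × Q ((λ _ → 0#) , β))
  farkas {ℕ.zero} [] = inj₁ ((λ ()) , [])
  farkas {ℕ.zero} ((a , β) ∷ rs) with β ≤? 0# | farkas rs
  ... | no β≰0  | _               = inj₂ λ { cone (q ∷ _) →
                                      β , β≰0 , ConvexCone.resp cone ((λ ()) , refl) q }
  ... | yes β≤0 | inj₁ (x , sat)  = inj₁ (x , β≤0 ∷ sat)
  ... | yes β≤0 | inj₂ refutation = inj₂ λ { cone (_ ∷ qs) → refutation cone qs }
  farkas {ℕ.suc n} rs with eliminate rs
  ... | rs′ , solve , combine with farkas rs′
  ...   | inj₁ (x , sat) = let z , sat′ = solve x sat in inj₁ (z Vec.∷ x , sat′)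
  ...   | inj₂ refutation = inj₂ λ cone qs →
          let β , β≰0 , q = refutation (consZero-convexCone cone) (combine cone qs) in
          β , β≰0 , ConvexCone.resp cone ((λ { zero → refl ; (suc i) → refl }) , refl) q

-- Strong duality.

module StrongDuality (ℝ : RealNumbers) {M N : ℕ}
                     (Pl : LinearProgramming.LinearProgram ℝ M N) where
  open DotProduct ℝ
  open Farkas ℝ
  open LinearProgram Pl

  Aᵀ : Vector Carrier M → Vector Carrier N
  Aᵀ u n = (λ m → A m n) ∙ u

  reducedCost-nonNegative : ∀ {u} → (∀ n → Aᵀ u n ≤ c n) → ∀ n → 0# ≤ reducedCost u n
  reducedCost-nonNegative Aᵀu≤c n = x≤y⇒0≤y-x (Aᵀu≤c n)

  module _ {y : Vector Carrier M} (y-optimal : DualOptimal y) where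
    private
      0≤y   = proj₁ (proj₁ y-optimal)
      Aᵀy≤c = λ n → 0≤y-x⇒x≤y (proj₂ (proj₁ y-optimal) n)

    -- The first row is `c ∙ x ≤ b ∙ y` with both sides negated, to match the orientation of `Row`.
    -- A solution is thus a feasible point whose objective does not exceed the dual optimum.
    rows : List (Row N)
    rows = ((λ n → - c n) , - (b ∙ y)) ∷
           tabulate (λ m → A m , b m) ++ tabulate (λ n → unit n , 0#)

    -- With multiplier t on the objective row and u on the constraints,
    -- the sign constraints leave "≤" in place of "=" on the coefficients.
    Consequence : Row N → Set
    Consequence (a , β) = ∃ λ t → ∃ λ u → 0# ≤ t × (∀ m → 0# ≤ u m) ×
      (∀ n → Aᵀ u n ≤ t * c n + a n) × β + t * (b ∙ y) ≤ b ∙ u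

    consequence-convexCone : ConvexCone Consequence
    consequence-convexCone = record
      { resp  = λ { (a≈a′ , β≈β′) (t , u , 0≤t , 0≤u , Aᵀu≤ , β≤) →
          t , u , 0≤t , 0≤u ,
          (λ n → ≤-trans (Aᵀu≤ n) (≤-reflexive (+-congˡ (a≈a′ n)))) ,
          ≤-trans (≤-reflexive (+-congʳ (sym β≈β′))) β≤ }
      ; add   = λ { {a , β} {a′ , β′} (t , u , 0≤t , 0≤u , Aᵀu≤ , β≤) (t′ , u′ , 0≤t′ , 0≤u′ , Aᵀu′≤ , β′≤) →
          t + t′ , (λ m → u m + u′ m) , +-nonNegative 0≤t 0≤t′ ,
          (λ m → +-nonNegative (0≤u m) (0≤u′ m)) ,
          (λ n → begin
            Aᵀ (λ m → u m + u′ m) n                  ≈⟨ ∙-distribˡ-+ (λ m → A m n) u u′ ⟩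
            Aᵀ u n + Aᵀ u′ n                         ≤⟨ +-mono-≤ (Aᵀu≤ n) (Aᵀu′≤ n) ⟩
            (t * c n + a n) + (t′ * c n + a′ n)      ≈⟨ +-interchange (t * c n) (a n) (t′ * c n) (a′ n) ⟩
            (t * c n + t′ * c n) + (a n + a′ n)      ≈⟨ +-congʳ (distribʳ (c n) t t′) ⟨
            (t + t′) * c n + (a n + a′ n)            ∎) ,
          (begin
            β + β′ + (t + t′) * (b ∙ y)                  ≈⟨ +-congˡ (distribʳ (b ∙ y) t t′) ⟩
            β + β′ + (t * (b ∙ y) + t′ * (b ∙ y))        ≈⟨ +-interchange β β′ (t * (b ∙ y)) (t′ * (b ∙ y)) ⟩
            (β + t * (b ∙ y)) + (β′ + t′ * (b ∙ y))      ≤⟨ +-mono-≤ β≤ β′≤ ⟩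
            b ∙ u + b ∙ u′                               ≈⟨ ∙-distribˡ-+ b u u′ ⟨
            b ∙ (λ m → u m + u′ m)                       ∎) }
      ; scale = λ { {s} {a , β} 0≤s (t , u , 0≤t , 0≤u , Aᵀu≤ , β≤) →
          s * t , (λ m → s * u m) , *-nonNegative 0≤s 0≤t ,
          (λ m → *-nonNegative 0≤s (0≤u m)) ,
          (λ n → begin
            Aᵀ (λ m → s * u m) n          ≈⟨ ∙-scaleʳ s (λ m → A m n) u ⟩
            s * Aᵀ u n                    ≤⟨ *-monoˡ-≤-nonNeg 0≤s (Aᵀu≤ n) ⟩
            s * (t * c n + a n)           ≈⟨ distribˡ s (t * c n) (a n) ⟩
            s * (t * c n) + s * a n       ≈⟨ +-congʳ (*-assoc s t (c n)) ⟨
            s * t * c n + s * a n         ∎) ,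
          (begin
            s * β + s * t * (b ∙ y)       ≈⟨ +-congˡ (*-assoc s t (b ∙ y)) ⟩
            s * β + s * (t * (b ∙ y))     ≈⟨ distribˡ s β (t * (b ∙ y)) ⟨
            s * (β + t * (b ∙ y))         ≤⟨ *-monoˡ-≤-nonNeg 0≤s β≤ ⟩
            s * (b ∙ u)                   ≈⟨ ∙-scaleʳ s b u ⟨
            b ∙ (λ m → s * u m)           ∎) }
      }

    -- The objective row has `t` = 1 and `u` = 0, a constraint row `t` = 0 and a unit vector `u`.
    -- For a sign row both multipliers vanish and the inequality on the coefficients absorbs the
    -- unit vector.
    rows-consequences : All Consequence rows
    rows-consequences = objective-row ∷
      All.++⁺ (All.tabulate⁺ constraint-row) (All.tabulate⁺ sign-row)
      where
      0*x+y≈y : ∀ x y → 0# * x + y ≈ y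
      0*x+y≈y x y = trans (+-congʳ (zeroˡ x)) (+-identityˡ y)

      objective-row : Consequence ((λ n → - c n) , - (b ∙ y))
      objective-row = 1# , (λ _ → 0#) , 0≤1 , (λ _ → ≤-refl) ,
        (λ n → ≤-reflexive (begin-equality
          Aᵀ (λ _ → 0#) n    ≈⟨ ∙-zeroʳ (λ m → A m n) ⟩
          0#                 ≈⟨ -‿inverseʳ (c n) ⟨
          c n - c n          ≈⟨ +-congʳ (*-identityˡ (c n)) ⟨
          1# * c n - c n     ∎)) ,
        ≤-reflexive (begin-equality
          - (b ∙ y) + 1# * (b ∙ y)  ≈⟨ +-congˡ (*-identityˡ (b ∙ y)) ⟩
          - (b ∙ y) + b ∙ y         ≈⟨ -‿inverseˡ (b ∙ y) ⟩
          0#                        ≈⟨ ∙-zeroʳ b ⟨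
          b ∙ (λ _ → 0#)            ∎)

      constraint-row : ∀ m → Consequence (A m , b m)
      constraint-row m = 0# , unit m , ≤-refl , unit-nonNegative m ,
        (λ n → ≤-reflexive (trans (∙-unit (λ m′ → A m′ n) m) (sym (0*x+y≈y (c n) (A m n))))) ,
        ≤-reflexive (trans (+-comm _ _) (trans (0*x+y≈y (b ∙ y) (b m)) (sym (∙-unit b m))))

      sign-row : ∀ n → Consequence (unit n , 0#)
      sign-row n = 0# , (λ _ → 0#) , ≤-refl , (λ _ → ≤-refl) ,
        (λ n′ → begin
          Aᵀ (λ _ → 0#) n′           ≈⟨ ∙-zeroʳ (λ m → A m n′) ⟩
          0#                         ≤⟨ unit-nonNegative n n′ ⟩
          unit n n′                  ≈⟨ 0*x+y≈y (c n′) (unit n n′) ⟨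
          0# * c n′ + unit n n′      ∎) ,
        ≤-reflexive (trans (+-comm _ _) (trans (0*x+y≈y (b ∙ y) 0#) (sym (∙-zeroʳ b))))

    -- u / t improves on y if t > 0, and the ray y + u does if t = 0.
    dual-bound : ∀ {t u} → 0# ≤ t → (∀ m → 0# ≤ u m) → (∀ n → Aᵀ u n ≤ t * c n) →
                 b ∙ u ≤ t * (b ∙ y)
    dual-bound {t} {u} 0≤t 0≤u Aᵀu≤tc with t ≟ 0#
    ... | yes t≈0 = +-cancelʳ-≤ (b ∙ y) (begin
      b ∙ u + b ∙ y                ≈⟨ ∙-distribˡ-+ b u y ⟨
      b ∙ (λ m → u m + y m)        ≤⟨ proj₂ y-optimal _ (u+y-nonNegative , reducedCost-nonNegative Aᵀ[u+y]≤c) ⟩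
      b ∙ y                        ≈⟨ +-identityˡ (b ∙ y) ⟨
      0# + b ∙ y                   ≈⟨ +-congʳ (zeroˡ (b ∙ y)) ⟨
      0# * (b ∙ y) + b ∙ y         ≈⟨ +-congʳ (*-congʳ t≈0) ⟨
      t * (b ∙ y) + b ∙ y          ∎)
      where
      u+y-nonNegative = λ m → +-nonNegative (0≤u m) (0≤y m)
      Aᵀ[u+y]≤c : ∀ n → Aᵀ (λ m → u m + y m) n ≤ c n
      Aᵀ[u+y]≤c n = begin
        Aᵀ (λ m → u m + y m) n   ≈⟨ ∙-distribˡ-+ (λ m → A m n) u y ⟩
        Aᵀ u n + Aᵀ y n          ≤⟨ +-mono-≤ (Aᵀu≤tc n) (Aᵀy≤c n) ⟩
        t * c n + c n            ≈⟨ +-congʳ (*-congʳ t≈0) ⟩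
        0# * c n + c n           ≈⟨ +-congʳ (zeroˡ (c n)) ⟩
        0# + c n                 ≈⟨ +-identityˡ (c n) ⟩
        c n                      ∎
    ... | no t≉0 with inverse-nonNegative 0≤t t≉0
    ...   | s , 0≤s , ts≈1 = begin
      b ∙ u                          ≈⟨ t[sx]≈x (b ∙ u) ⟨
      t * (s * (b ∙ u))              ≈⟨ *-congˡ (∙-scaleʳ s b u) ⟨
      t * (b ∙ (λ m → s * u m))      ≤⟨ *-monoˡ-≤-nonNeg 0≤t (proj₂ y-optimal _
                                          ((λ m → *-nonNegative 0≤s (0≤u m)) , reducedCost-nonNegative Aᵀ[su]≤c)) ⟩
      t * (b ∙ y)                    ∎
      where
      t[sx]≈x : ∀ x → t * (s * x) ≈ x
      t[sx]≈x x = trans (sym (*-assoc t s x)) (trans (*-congʳ ts≈1) (*-identityˡ x))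
      Aᵀ[su]≤c : ∀ n → Aᵀ (λ m → s * u m) n ≤ c n
      Aᵀ[su]≤c n = begin
        Aᵀ (λ m → s * u m) n   ≈⟨ ∙-scaleʳ s (λ m → A m n) u ⟩
        s * Aᵀ u n             ≤⟨ *-monoˡ-≤-nonNeg 0≤s (Aᵀu≤tc n) ⟩
        s * (t * c n)          ≈⟨ x*yz≈y*xz s t (c n) ⟩
        t * (s * c n)          ≈⟨ t[sx]≈x (c n) ⟩
        c n                    ∎

    -- A refutation of `rows` would be a `Consequence` with zero coefficients and `β` not at most 0,
    -- that is, multipliers for which `b ∙ u` exceeds `t * (b ∙ y)`, against `dual-bound`.
    primal-attains-dual : ∃ λ x → Feasible x × c ∙ x ≤ b ∙ y
    primal-attains-dual with farkas rows
    ... | inj₁ (x , objective-sat ∷ sat) =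
      x , (All.tabulate⁻ (All.++⁻ˡ (tabulate _) sat) , 0≤x) , cx≤by
      where
      0≤x : ∀ n → 0# ≤ x n
      0≤x n = begin
        0#           ≤⟨ All.tabulate⁻ (All.++⁻ʳ (tabulate λ m → A m , b m) sat) n ⟩
        unit n ∙ x   ≈⟨ ∙-comm (unit n) x ⟩
        x ∙ unit n   ≈⟨ ∙-unit x n ⟩
        x n          ∎
      cx≤by : c ∙ x ≤ b ∙ y
      cx≤by = begin
        c ∙ x                    ≈⟨ ∙-comm c x ⟩
        x ∙ c                    ≈⟨ -‿involutive (x ∙ c) ⟨
        - - (x ∙ c)              ≈⟨ -‿cong (∙-negʳ x c) ⟨
        - (x ∙ (λ n → - c n))    ≈⟨ -‿cong (∙-comm x _) ⟩
        - ((λ n → - c n) ∙ x)    ≤⟨ -‿anti-≤ objective-sat ⟩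
        - - (b ∙ y)              ≈⟨ -‿involutive (b ∙ y) ⟩
        b ∙ y                    ∎
    ... | inj₂ refutation with refutation consequence-convexCone rows-consequences
    ...   | β , β≰0 , t , u , 0≤t , 0≤u , Aᵀu≤ , β≤ = contradiction β≤0 β≰0
      where
      Aᵀu≤tc : ∀ n → Aᵀ u n ≤ t * c n
      Aᵀu≤tc n = ≤-trans (Aᵀu≤ n) (≤-reflexive (+-identityʳ (t * c n)))
      β≤0 : β ≤ 0#
      β≤0 = +-cancelʳ-≤ (t * (b ∙ y)) (begin
        β + t * (b ∙ y)    ≤⟨ β≤ ⟩
        b ∙ u              ≤⟨ dual-bound 0≤t 0≤u Aᵀu≤tc ⟩
        t * (b ∙ y)        ≈⟨ +-identityˡ (t * (b ∙ y)) ⟨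
        0# + t * (b ∙ y)   ∎)

-- Slacks and the duality gap.

module Slackness (ℝ : RealNumbers) {M N : ℕ}
                 (Pl : LinearProgramming.LinearProgram ℝ M N) where
  open DotProduct ℝ
  open LinearProgram Pl

  slack : Vector Carrier N → Vector Carrier M
  slack x m = A m ∙ x - b m

  slack-nonNegative : ∀ {x} → Feasible x → ∀ m → 0# ≤ slack x m
  slack-nonNegative (b≤Ax , _) m = x≤y⇒0≤y-x (b≤Ax m)

  slack-∙ : ∀ x v → slack x ∙ v ≈ v ∙ (λ m → A m ∙ x) - b ∙ v
  slack-∙ x v = begin-equality
    slack x ∙ v                    ≈⟨ ∙-comm (slack x) v ⟩
    v ∙ slack x                    ≈⟨ ∙-distribˡ-- v (λ m → A m ∙ x) b ⟩
    v ∙ (λ m → A m ∙ x) - v ∙ b    ≈⟨ +-congˡ (-‿cong (∙-comm v b)) ⟩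
    v ∙ (λ m → A m ∙ x) - b ∙ v    ∎

  telescope : ∀ p q r → (p - q) + (r - p) ≈ r - q
  telescope p q r = begin-equality
    (p - q) + (r - p)      ≈⟨ +-comm (p - q) (r - p) ⟩
    (r - p) + (p - q)      ≈⟨ +-assoc (r - p) p (- q) ⟨
    (r - p + p) - q        ≈⟨ +-congʳ (x-y+y≈x p r) ⟩
    r - q                  ∎

  -- The terms are `q - b ∙ y` and `c ∙ x - q` with the same `q`, by `∙-adjoint`, so `q` telescopes
  -- away.
  duality-gap : ∀ x y → slack x ∙ y + x ∙ reducedCost y ≈ c ∙ x - b ∙ y
  duality-gap x y = begin-equality
    slack x ∙ y + x ∙ reducedCost y   ≈⟨ +-cong (slack-∙ x y) xr≈ ⟩
    (q - b ∙ y) + (c ∙ x - q)         ≈⟨ telescope q (b ∙ y) (c ∙ x) ⟩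
    c ∙ x - b ∙ y                     ∎
    where
    q = y ∙ (λ m → A m ∙ x)
    xr≈ : x ∙ reducedCost y ≈ c ∙ x - q
    xr≈ = trans (∙-distribˡ-- x c (λ n → sum (λ m → A m n * y m)))
                (+-cong (∙-comm x c) (-‿cong (∙-adjoint A x y)))

  weak-duality : ∀ {x y} → Feasible x → DualFeasible y → b ∙ y ≤ c ∙ x
  weak-duality {x} {y} x-feasible (0≤y , 0≤r) = 0≤y-x⇒x≤y (begin
    0#                                ≤⟨ +-nonNegative
                                           (sum-nonNegative λ m → *-nonNegative (slack-nonNegative x-feasible m) (0≤y m))
                                           (sum-nonNegative λ n → *-nonNegative (proj₂ x-feasible n) (0≤r n)) ⟩
    slack x ∙ y + x ∙ reducedCost y   ≈⟨ duality-gap x y ⟩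
    c ∙ x - b ∙ y                     ∎)

-- Lower bounds from the case differentiations.

module CaseBounds (ℝ : RealNumbers) {M N : ℕ}
                  {Pl : LinearProgramming.LinearProgram ℝ M N}
                  (P : LinearProgramming.Problem ℝ Pl)
                  (ω₀ : RealNumbers.Carrier ℝ) (y : Vector (RealNumbers.Carrier ℝ) M) where
  open DotProduct ℝ
  open Slackness ℝ Pl
  open LinearProgram Pl
  open Problem P
  open Files P ω₀ y

  x-[x+y]≈-y : ∀ x y → x - (x + y) ≈ - y
  x-[x+y]≈-y x y = begin-equality
    x - (x + y)        ≈⟨ +-congˡ (-‿+-comm x y) ⟨
    x + (- x - y)      ≈⟨ +-assoc x (- x) (- y) ⟨
    x - x - y          ≈⟨ +-congʳ (-‿inverseʳ x) ⟩
    0# - y             ≈⟨ +-identityˡ (- y) ⟩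
    - y                ∎

  -- By `duality-gap` the value at `l` is `c ∙ x - b ∙ y`. Linearity in `δ` carries it through the
  -- sum in `Δ𝒫`, and nonnegative weights make it monotone at feasible `x`.
  weighted : Vector Carrier N → (Index → Carrier) → Carrier
  weighted x δ = slack x ∙ (λ m → δ (inj₁ m)) + x ∙ (λ n → δ (inj₂ n))

  weighted-mono-≤ : ∀ {x} → Feasible x → ∀ {δ δ′} → (∀ r → δ r ≤ δ′ r) → weighted x δ ≤ weighted x δ′
  weighted-mono-≤ x-feasible δ≤δ′ = +-mono-≤
    (∙-monoʳ-≤ (slack-nonNegative x-feasible) (λ m → δ≤δ′ (inj₁ m)))
    (∙-monoʳ-≤ (proj₂ x-feasible) (λ n → δ≤δ′ (inj₂ n)))

  weighted-sum : ∀ x {k} (δ : Fin k → Index → Carrier) →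
                 weighted x (λ r → sum (λ i → δ i r)) ≈ sum (λ i → weighted x (δ i))
  weighted-sum x δ = trans
    (+-cong (∙-distribˡ-sum (slack x) (λ i m → δ i (inj₁ m)))
            (∙-distribˡ-sum x (λ i n → δ i (inj₂ n))))
    (sym (∑-distrib-+ (λ i → slack x ∙ (λ m → δ i (inj₁ m))) (λ i → x ∙ (λ n → δ i (inj₂ n)))))

  module _ {i : I} {j : J i} (w : Cᵢⱼ i j) where
    open Case (case i j)
    private
      v = proj₁ (proj₁ w)
      z = proj₂ (proj₁ w)

    -- `embed` puts 0 in the `z` part, so feasibility of the shifted point passes to `z` itself.
    -- Entries of `v` can be negative, so `v` enters the case bound only through identities.
    z-nonNegative : ∀ k → 0# ≤ z k
    z-nonNegative k = ≤-trans (proj₁ (proj₂ (proj₁ (proj₂ w))) k) (≤-reflexive (+-identityˡ (z k)))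

    -- Reduced cost is affine in the dual point, so `c` and `y` cancel in the difference and the
    -- part linear in `v` and `z` remains.
    Δᵢⱼ-column : ∀ n → Δᵢⱼ i j w (inj₂ n) ≈ sum (λ m → A m n * v m) + sum (λ k → d k n * z k)
    Δᵢⱼ-column n = begin-equality
      (c n - Ay) - ((c n - sum (λ m → A m n * (y m + v m))) - sum (λ k → d k n * (0# + z k)))
        ≈⟨ +-congˡ (-‿cong (+-cong (+-congˡ (-‿cong (∙-distribˡ-+ (λ m → A m n) y v)))
                                    (-‿cong (∙-congˡ (λ k → d k n) (λ k → +-identityˡ (z k)))))) ⟩
      (c n - Ay) - ((c n - (Ay + Av)) - dz)
        ≈⟨ +-congˡ (-‿cong regroup) ⟩
      (c n - Ay) - ((c n - Ay) + - (Av + dz))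
        ≈⟨ x-[x+y]≈-y (c n - Ay) (- (Av + dz)) ⟩
      - - (Av + dz)
        ≈⟨ -‿involutive (Av + dz) ⟩
      Av + dz ∎
      where
      Ay = sum (λ m → A m n * y m)
      Av = sum (λ m → A m n * v m)
      dz = sum (λ k → d k n * z k)
      regroup : (c n - (Ay + Av)) - dz ≈ (c n - Ay) + - (Av + dz)
      regroup = begin-equality
        (c n - (Ay + Av)) - dz       ≈⟨ +-congʳ (+-congˡ (-‿+-comm Ay Av)) ⟨
        (c n + (- Ay - Av)) - dz     ≈⟨ +-congʳ (+-assoc (c n) (- Ay) (- Av)) ⟨
        (c n - Ay - Av) - dz         ≈⟨ +-assoc (c n - Ay) (- Av) (- dz) ⟩
        (c n - Ay) + (- Av - dz)     ≈⟨ +-congˡ (-‿+-comm Av dz) ⟩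
        (c n - Ay) + - (Av + dz)     ∎

    -- Rows contribute `b ∙ v - p` and columns `p + q`, so `p` cancels and `b ∙ v + q` is left. As
    -- `z` is nonnegative and `x` satisfies the case, `q` is at least `e ∙ z`.
    ωᵢⱼ≤weighted : ∀ {x} → Satisfies x → ωᵢⱼ i j w ≤ weighted x (Δᵢⱼ i j w)
    ωᵢⱼ≤weighted {x} x-sat = begin
      b ∙ v + e ∙ z                    ≤⟨ +-monoʳ-≤ (b ∙ v) ez≤q ⟩
      b ∙ v + q                        ≈⟨ +-congʳ -[p-bv]+p≈bv ⟨
      (- (p - b ∙ v) + p) + q          ≈⟨ +-assoc (- (p - b ∙ v)) p q ⟩
      - (p - b ∙ v) + (p + q)          ≈⟨ +-cong row column ⟨
      weighted x (Δᵢⱼ i j w)           ∎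
      where
      p = v ∙ (λ m → A m ∙ x)
      q = z ∙ (λ k → d k ∙ x)
      ez≤q : e ∙ z ≤ q
      ez≤q = ≤-trans (≤-reflexive (∙-comm e z)) (∙-monoʳ-≤ z-nonNegative x-sat)
      -[p-bv]+p≈bv : - (p - b ∙ v) + p ≈ b ∙ v
      -[p-bv]+p≈bv = trans (+-congʳ (-‿anti-homo‿- p (b ∙ v))) (x-y+y≈x p (b ∙ v))
      row : slack x ∙ (λ m → Δᵢⱼ i j w (inj₁ m)) ≈ - (p - b ∙ v)
      row = begin-equality
        slack x ∙ (λ m → y m - (y m + v m))   ≈⟨ ∙-congˡ (slack x) (λ m → x-[x+y]≈-y (y m) (v m)) ⟩
        slack x ∙ (λ m → - v m)               ≈⟨ ∙-negʳ (slack x) v ⟩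
        - (slack x ∙ v)                       ≈⟨ -‿cong (slack-∙ x v) ⟩
        - (p - b ∙ v)                         ∎
      column : x ∙ (λ n → Δᵢⱼ i j w (inj₂ n)) ≈ p + q
      column = begin-equality
        x ∙ (λ n → Δᵢⱼ i j w (inj₂ n))
          ≈⟨ ∙-congˡ x Δᵢⱼ-column ⟩
        x ∙ (λ n → sum (λ m → A m n * v m) + sum (λ k → d k n * z k))
          ≈⟨ ∙-distribˡ-+ x (λ n → sum (λ m → A m n * v m)) (λ n → sum (λ k → d k n * z k)) ⟩
        x ∙ (λ n → sum (λ m → A m n * v m)) + x ∙ (λ n → sum (λ k → d k n * z k))
          ≈⟨ +-cong (∙-adjoint A x v) (∙-adjoint d x z) ⟩
        p + q ∎

    -- By linearity the value at the shifted point is `b ∙ y` plus the value at `w`. Membership in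
    -- `Pᵢⱼ` makes it at least `ω₀`, hence at least `b ∙ y`, which cancels.
    ωᵢⱼ-nonNegative : b ∙ y ≤ ω₀ → 0# ≤ ωᵢⱼ i j w
    ωᵢⱼ-nonNegative by≤ω₀ = +-cancelʳ-≤ (b ∙ y) (begin
      0# + b ∙ y                                               ≈⟨ +-identityˡ (b ∙ y) ⟩
      b ∙ y                                                    ≤⟨ by≤ω₀ ⟩
      ω₀                                                       ≤⟨ proj₂ (proj₂ w) ⟩
      b ∙ (λ m → y m + v m) + e ∙ (λ k → 0# + z k)             ≈⟨ +-cong (∙-distribˡ-+ b y v) (∙-congˡ e (λ k → +-identityˡ (z k))) ⟩
      b ∙ y + b ∙ v + e ∙ z                                    ≈⟨ +-assoc (b ∙ y) (b ∙ v) (e ∙ z) ⟩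
      b ∙ y + (b ∙ v + e ∙ z)                                  ≈⟨ +-comm (b ∙ y) _ ⟩
      b ∙ v + e ∙ z + b ∙ y                                    ∎)

  -- `Δ≤l` says that all differentiations together use up no more than `l`, so their bounds may be
  -- added against a single duality gap.
  sum-ωᵢ-bound : ∀ (p : 𝒫) → (∀ r → Δ𝒫 p r ≤ l r) → ∀ {x} → FeasibleP x →
                 b ∙ y + sum (λ i → ωᵢ i (p i)) ≤ c ∙ x
  sum-ωᵢ-bound p Δ≤l {x} x-feasibleP = begin
    b ∙ y + sum (λ i → ωᵢ i (p i))                ≤⟨ +-monoʳ-≤ (b ∙ y) (sum-mono-≤ bound) ⟩
    b ∙ y + sum (λ i → weighted x (Δᵢ i (p i)))   ≈⟨ +-congˡ (weighted-sum x (λ i → Δᵢ i (p i))) ⟨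
    b ∙ y + weighted x (Δ𝒫 p)                     ≤⟨ +-monoʳ-≤ (b ∙ y) (weighted-mono-≤ x-feasible Δ≤l) ⟩
    b ∙ y + weighted x l                          ≈⟨ +-congˡ (duality-gap x y) ⟩
    b ∙ y + (c ∙ x - b ∙ y)                       ≈⟨ +-comm (b ∙ y) (c ∙ x - b ∙ y) ⟩
    c ∙ x - b ∙ y + b ∙ y                         ≈⟨ x-y+y≈x (b ∙ y) (c ∙ x) ⟩
    c ∙ x                                         ∎
    where
    x-feasible = P⊆Pl x x-feasibleP
    bound : ∀ i → ωᵢ i (p i) ≤ weighted x (Δᵢ i (p i))
    -- The case satisfied varies with `x`; the minimum in `ωᵢ` and the maximum in `Δᵢ` cover
    -- whichever it is.
    bound i = let j , x-sat = exhaustive i x x-feasibleP in begin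
      ωᵢ i (p i)                        ≤⟨ minimum-≤ (λ j → ωᵢⱼ i j (p i j)) j ⟩
      ωᵢⱼ i j (p i j)                   ≤⟨ ωᵢⱼ≤weighted (p i j) x-sat ⟩
      weighted x (Δᵢⱼ i j (p i j))      ≤⟨ weighted-mono-≤ x-feasible (λ r → maximum-≥ (λ j → Δᵢⱼ i j (p i j) r) j) ⟩
      weighted x (Δᵢ i (p i))           ∎

theorem2p6 : (ℝ : RealNumbers) → let open LinearProgramming ℝ in
    {M N : ℕ} (Pl : LinearProgram M N) → let open LinearProgram Pl in
    (ω₀ : Carrier) → IsOptimalValue Feasible objective [ ω₀ ] →
    (P : Problem Pl) → let open Problem P in
    (y : Vector Carrier M) → DualOptimal y →
    let open Files P ω₀ y in
    (p : 𝒫) → (∀ r → Δ𝒫 p r ≤ l r) →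
    (∀ (v : Carrier ±) → IsOptimalValue FeasibleP objective v → [ ω𝒫 p ] ≤± v) ×
    (ω₀ ≤ ω𝒫 p)
theorem2p6 ℝ {M} {N} Pl ω₀ (ω₀-lower , ω₀-greatest) P y y-optimal p Δ≤l =
  -- `v` is the greatest lower bound in the extended reals, so it suffices that `ω𝒫 p` is a lower
  -- bound; this is vacuous if `P` has no feasible point.
  (λ v v-optimal → proj₂ v-optimal [ ω𝒫 p ] λ x x∈P → ≤±[ ω𝒫≤cx x∈P ]) , ω₀≤ω𝒫
  where
  open DotProduct ℝ
  open LinearProgram Pl
  open Problem P
  open Files P ω₀ y
  open StrongDuality ℝ Pl
  open Slackness ℝ Pl
  open CaseBounds ℝ P ω₀ y
  open Extrema _≤_ using ([≤]-injective) renaming ([_] to ≤±[_])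

  -- `ω₀` is at most the objective at the feasible point supplied by strong duality.
  ω₀≤by : ω₀ ≤ b ∙ y
  ω₀≤by = let x , x-feasible , cx≤by = primal-attains-dual y-optimal in
    ≤-trans ([≤]-injective (ω₀-lower x x-feasible)) cx≤by

  by≤ω₀ : b ∙ y ≤ ω₀
  by≤ω₀ = [≤]-injective (ω₀-greatest [ b ∙ y ] λ x x-feasible →
    ≤±[ weak-duality x-feasible (proj₁ y-optimal) ])

  ω𝒫≤cx : ∀ {x} → FeasibleP x → ω𝒫 p ≤ c ∙ x
  ω𝒫≤cx x∈P = ≤-trans (+-monoˡ-≤ _ ω₀≤by) (sum-ωᵢ-bound p Δ≤l x∈P)

  ω₀≤ω𝒫 : ω₀ ≤ ω𝒫 p
  ω₀≤ω𝒫 = begin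
    ω₀         ≈⟨ +-identityʳ ω₀ ⟨
    ω₀ + 0#    ≤⟨ +-monoʳ-≤ ω₀ (sum-nonNegative λ i →
                    minimum-nonNegative (λ j → ωᵢⱼ-nonNegative (p i j) by≤ω₀)) ⟩
    ω𝒫 p       ∎
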